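{- Let $\mathcal C$ be a class of graphs such that there is a bound on the number of edges of the graphs in $\mathcal C$. Then $\mathcal C$ has a right hom algorithm.
   Context: Graphs are finite, simple, undirected, with non-empty vertex set; classes are closed under isomorphism. $\hom(G,F)$ is the number of homomorphisms from $G$ to $F$. A class $\mathcal C$ has (can be decided by) a right hom algorithm if there are $k\ge1$ and graphs $F_1,\dots,F_k$ such that for all graphs $G,H$: if $\hom(G,F_i)=\hom(H,F_i)$ for all $i\in[k]$, then ($G\in\mathcal C\iff H\in\mathcal C$). -}

module Defs where

open import Data.Nat using (ℕ; zero; suc; _≤_; _<_; _<ᵇ_)
open import Data.Bool using (Bool; true; false; _∧_; _∨_; not)
open import Data.Fin using (Fin; toℕ)
open import Data.Vec using (Vec; []; _∷_; lookup)
open import Data.List using (List; []; _∷_; [_]; length; filterᵇ; allFin; concatMap; map; cartesianProduct)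
open import Data.Bool.ListAction using (all)
open import Data.Product using (Σ; _×_; _,_; proj₁; proj₂)
open import Function.Bundles using (_↔_; Inverse)
open import Relation.Binary.PropositionalEquality using (_≡_)

record Graph : Set where
  field
    size     : ℕ
    nonEmpty : 0 < size
    adj      : Fin size → Fin size → Bool
    adj-sym  : ∀ i j → adj i j ≡ adj j i
    adj-irr  : ∀ i → adj i i ≡ false
open Graph public

pairs : (G : Graph) → List (Fin (size G) × Fin (size G))
pairs G = cartesianProduct (allFin (size G)) (allFin (size G))

edges : Graph → ℕ
edges G = length (filterᵇ (λ p → (toℕ (proj₁ p) <ᵇ toℕ (proj₂ p)) ∧ adj G (proj₁ p) (proj₂ p)) (pairs G))

allMaps : (m n : ℕ) → List (Vec (Fin n) m)
allMaps zero    n = [ [] ]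
allMaps (suc m) n = concatMap (λ v → map (_∷ v) (allFin n)) (allMaps m n)

isHom : (G F : Graph) → Vec (Fin (size F)) (size G) → Bool
isHom G F f = all (λ p → not (adj G (proj₁ p) (proj₂ p)) ∨ adj F (lookup f (proj₁ p)) (lookup f (proj₂ p))) (pairs G)

hom : Graph → Graph → ℕ
hom G F = length (filterᵇ (isHom G F) (allMaps (size G) (size F)))

_≅_ : Graph → Graph → Set
G ≅ H = Σ (Fin (size G) ↔ Fin (size H)) λ φ →
          ∀ i j → adj H (Inverse.to φ i) (Inverse.to φ j) ≡ adj G i j

-- a class of graphs: a predicate closed under isomorphism
ClosedUnderIso : (Graph → Set) → Set
ClosedUnderIso C = ∀ G H → G ≅ H → C G → C H

EdgeBounded : (Graph → Set) → Set
EdgeBounded C = Σ ℕ λ b → ∀ G → C G → edges G ≤ b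

HasRightHomAlgorithm : (Graph → Set) → Set
HasRightHomAlgorithm C =
  Σ ℕ λ k → 1 ≤ k × Σ (Fin k → Graph) λ F →
    ∀ G H → (∀ i → hom G (F i) ≡ hom H (F i)) →
      (C G → C H) × (C H → C G)

{-# OPTIONS --safe #-}
module Submission where

-- Suppose G has at most b edges and H has the same number of homomorphisms as G to every graph
-- with at most 2b + 2 vertices; we show G ≅ H.
--
-- Adding an isolated point to a target F changes hom(G, F) ≠ 0 exactly when G has an isolated
-- vertex.  With F complete on 2b + 1 vertices this shows that G has an isolated vertex iff H has
-- one; deleting it divides all counts by |F|, so we may induct until neither graph has one.
--
-- Then G has at most 2b vertices, and inclusion–exclusion over images shows that G and H have
-- equally many surjective homomorphisms to every target.  The identity of G yields a surjective
-- homomorphism H → G.  If it were not injective, recolouring one vertex would map H onto the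
-- complete graph on |G| + 1 vertices, which G cannot do.  So |H| = |G|, there are bijective
-- homomorphisms both ways, and comparing edge counts they are isomorphisms.

open import Defs

open import Data.Bool using (Bool; true; false; not; T; T?; _∨_; _∧_; if_then_else_)
open import Data.Bool.Properties using (T-∧)
open import Data.Empty using (⊥-elim)
open import Data.Fin using (Fin; zero; suc; toℕ; punchIn; punchOut; combine; remQuot; inject≤)
open import Data.Fin.Permutation using (insert; insert-punchIn; _⟨$⟩ʳ_; ↔⇒≡)
open import Data.Fin.Properties using (0≢1+n; _≟_; any?; all?; ¬∀⟶∃¬; pigeonhole; injective⇒≤; punchIn-injective; punchIn-punchOut; punchOut-injective; suc-injective; remQuot-combine; inject≤-injective; toℕ-injective)
open import Data.List using (List; []; _∷_; _++_; length; filter; map; allFin; cartesianProduct; concatMap; upTo; lookup)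
open import Data.List.Properties using (length-++; length-map; length-tabulate; filter-≐)
open import Data.List.Membership.Propositional using (_∈_)
open import Data.List.Membership.Propositional.Properties using (∈-∃++; ∈-++⁺ˡ; ∈-++⁺ʳ; ∈-++⁻; ∈-map⁺; ∈-map⁻; ∈-filter⁺; ∈-filter⁻; ∈-allFin; ∈-cartesianProduct⁺; ∈-cartesianProduct⁻; ∈-concatMap⁺; ∈-upTo⁺; ∈-length)
open import Data.List.Relation.Unary.All using (All; []; _∷_)
import Data.List.Relation.Unary.All as All
import Data.List.Relation.Unary.All.Properties as All
open import Data.List.Relation.Unary.AllPairs using ([]; _∷_)
import Data.List.Relation.Unary.AllPairs as AllPairs
import Data.List.Relation.Unary.AllPairs.Properties as AllPairs
open import Data.List.Relation.Unary.Any using (here; there; index)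
import Data.List.Relation.Unary.Any as Any
open import Data.List.Relation.Unary.Any.Properties using (lookup-index)
open import Data.List.Relation.Unary.Unique.Propositional using (Unique)
import Data.List.Relation.Unary.Unique.Propositional.Properties as Unique
open import Data.Nat using (ℕ; zero; suc; _+_; _*_; _≤_; _<_; z≤n; s≤s; z<s; _<ᵇ_)
open import Data.Nat.Properties using (≤-refl; m≤m+n; ≤-trans; ≤-antisym; ≤-reflexive; <-irrefl; n<1+n; m≤n⇒m≤1+n; n≤1+n; +-suc; +-mono-≤; +-cancelʳ-≡; *-cancelˡ-≡; <-cmp; <⇒<ᵇ; _<?_; ≮⇒≥; module ≤-Reasoning)
open import Data.Product using (Σ; ∃; _×_; _,_; proj₁; proj₂; swap)
open import Data.Sum using (_⊎_; inj₁; inj₂)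
open import Data.Vec using (Vec; []; _∷_; tabulate; insertAt; removeAt; _[_]≔_)
import Data.Vec as Vec
open import Data.Vec.Properties using (lookup∘tabulate; tabulate∘lookup; tabulate-cong; lookup-map; insertAt-lookup; insertAt-punchIn; insertAt-removeAt; lookup∘update; lookup∘update′; ∷-injective)
open import Function using (_∘_; id; Equivalence; Injection; Inverse; mk↔ₛ′; _↔_)
open import Function.Properties.Inverse using (↔⇒↣)
open import Relation.Binary.Definitions using (tri<; tri≈; tri>)
open import Relation.Binary.PropositionalEquality
open import Relation.Nullary using (¬_; Dec; yes; no; contradiction; ¬?; _×-dec_; _⊎-dec_; _→-dec_)
open import Relation.Nullary.Decidable using (⌊_⌋; toWitness; fromWitness)
open import Relation.Unary using (Pred; Decidable)
open import Level using (0ℓ)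

private
  variable
    k m n : ℕ

-- Counting by injections between lists, and the list of all maps

-- Induction on `xs`: one occurrence of `f x` is cut out of `ys`, and injectivity keeps the
-- remaining images off that occurrence.
injection⇒length≤ : {X Y : Set} {xs : List X} {ys : List Y} (f : X → Y) → Unique xs →
  (∀ {x} → x ∈ xs → f x ∈ ys) →
  (∀ {x y} → x ∈ xs → y ∈ xs → f x ≡ f y → x ≡ y) →
  length xs ≤ length ys
injection⇒length≤ {xs = []} f u into inj = z≤n
injection⇒length≤ {xs = x ∷ xs} f (x∉xs ∷ u) into inj
  with as , bs , refl ← ∈-∃++ (into (here refl)) = begin
    suc (length xs)                ≤⟨ s≤s (injection⇒length≤ f u into′ (λ p q → inj (there p) (there q))) ⟩
    suc (length (as ++ bs))        ≡⟨ cong suc (length-++ as) ⟩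
    suc (length as + length bs)    ≡⟨ +-suc (length as) (length bs) ⟨
    length as + suc (length bs)    ≡⟨ length-++ as ⟨
    length (as ++ f x ∷ bs)        ∎
  where
  open ≤-Reasoning
  into′ : ∀ {z} → z ∈ xs → f z ∈ as ++ bs
  into′ z∈xs with ∈-++⁻ as (into (there z∈xs))
  ... | inj₁ p         = ∈-++⁺ˡ p
  ... | inj₂ (there p) = ∈-++⁺ʳ as p
  ... | inj₂ (here eq) = contradiction (inj (here refl) (there z∈xs) (sym eq)) (All.lookup x∉xs z∈xs)

⊆⇒length≤ : {X : Set} {xs ys : List X} → Unique xs → (∀ {x} → x ∈ xs → x ∈ ys) → length xs ≤ length ys
⊆⇒length≤ u xs⊆ys = injection⇒length≤ id u xs⊆ys (λ _ _ → id)

0<length⇒∃∈ : {X : Set} {xs : List X} → 0 < length xs → ∃ (_∈ xs)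
0<length⇒∃∈ {xs = x ∷ xs} _ = x , here refl

length-filter-split : {X : Set} {P Q : Pred X 0ℓ} (P? : Decidable P) (Q? : Decidable Q) (xs : List X) →
  length (filter P? xs) ≡
    length (filter (λ x → P? x ×-dec Q? x) xs) + length (filter (λ x → P? x ×-dec ¬? (Q? x)) xs)
length-filter-split P? Q? [] = refl
length-filter-split P? Q? (x ∷ xs) with P? x | Q? x
... | no _  | _     = length-filter-split P? Q? xs
... | yes _ | yes _ = cong suc (length-filter-split P? Q? xs)
... | yes _ | no _  = trans (cong suc (length-filter-split P? Q? xs)) (sym (+-suc _ _))

length-cartesianProduct : {X Y : Set} (xs : List X) (ys : List Y) →
  length (cartesianProduct xs ys) ≡ length xs * length ys
length-cartesianProduct []       ys = refl
length-cartesianProduct (x ∷ xs) ys = trans (length-++ (map (x ,_) ys))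
  (cong₂ _+_ (length-map (x ,_) ys) (length-cartesianProduct xs ys))

T-ext : ∀ {x y} → (T x → T y) → (T y → T x) → x ≡ y
T-ext {true}  {true}  _ _ = refl
T-ext {true}  {false} p _ = ⊥-elim (p _)
T-ext {false} {true}  _ q = ⊥-elim (q _)
T-ext {false} {false} _ _ = refl

lookup-injective : {X : Set} {f g : Vec X n} → (∀ i → Vec.lookup f i ≡ Vec.lookup g i) → f ≡ g
lookup-injective {f = f} {g} eq = trans (sym (tabulate∘lookup f)) (trans (tabulate-cong eq) (tabulate∘lookup g))

∈-allMaps : (f : Vec (Fin k) n) → f ∈ allMaps n k
∈-allMaps []      = here refl
∈-allMaps (x ∷ f) = ∈-concatMap⁺ _ (Any.map (λ { refl → ∈-map⁺ (_∷ f) (∈-allFin x) }) (∈-allMaps f))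

allMaps-unique : ∀ n k → Unique (allMaps n k)
allMaps-unique zero    k = [] ∷ []
allMaps-unique (suc n) k = Unique.concat⁺
  (All.map⁺ (All.universal (λ f → Unique.map⁺ (proj₁ ∘ ∷-injective) (Unique.allFin⁺ k)) _))
  (AllPairs.map⁺ (AllPairs.map disjoint (allMaps-unique n k)))
  where
  disjoint : {f g : Vec (Fin k) n} → f ≢ g → ∀ {h} → ¬ (h ∈ map (_∷ f) (allFin k) × h ∈ map (_∷ g) (allFin k))
  disjoint {f} {g} f≢g (p , q)
    with _ , _ , refl ← ∈-map⁻ (_∷ f) p | _ , _ , eq ← ∈-map⁻ (_∷ g) q = f≢g (proj₂ (∷-injective eq))

-- Graphs on `Fin n` and their homomorphisms

-- Unlike Graph, this allows the empty graph, which arises when isolated vertices are deleted.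
record FinGraph (n : ℕ) : Set where
  field
    edge     : Fin n → Fin n → Bool
    edge-sym : ∀ {i j} → T (edge i j) → T (edge j i)
    edge-irr : ∀ {i} → ¬ T (edge i i)
open FinGraph

fromDec : {R : Fin n → Fin n → Set} → (∀ i j → Dec (R i j)) →
  (∀ {i j} → R i j → R j i) → (∀ {i} → ¬ R i i) → FinGraph n
fromDec R? R-sym R-irr = record
  { edge     = λ i j → ⌊ R? i j ⌋
  ; edge-sym = λ {i} {j} e → fromWitness {a? = R? j i} (R-sym (toWitness {a? = R? i j} e))
  ; edge-irr = λ {i} e → R-irr (toWitness {a? = R? i i} e)
  }

complete : ∀ n → FinGraph n
complete n = fromDec (λ i j → ¬? (i ≟ j)) (λ i≢j → i≢j ∘ sym) (λ i≢i → i≢i refl)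

isolate : Fin n → FinGraph n → FinGraph n
isolate r F = fromDec (λ i j → T? (edge F i j) ×-dec ¬? (i ≟ r) ×-dec ¬? (j ≟ r))
  (λ { (e , p , q) → edge-sym F e , q , p }) (λ { (e , _) → edge-irr F e })

addPoint : FinGraph n → FinGraph (suc n)
addPoint {n} F = record { edge = e ; edge-sym = λ {i} {j} → e-sym i j ; edge-irr = λ {i} → e-irr i }
  where
  e : Fin (suc n) → Fin (suc n) → Bool
  e (suc i) (suc j) = edge F i j
  e _       _       = false
  e-sym : ∀ i j → T (e i j) → T (e j i)
  e-sym (suc i) (suc j) = edge-sym F
  e-irr : ∀ i → ¬ T (e i i)
  e-irr (suc i) = edge-irr F

delete : Fin (suc n) → FinGraph (suc n) → FinGraph n
delete v A = record
  { edge     = λ i j → edge A (punchIn v i) (punchIn v j)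
  ; edge-sym = edge-sym A
  ; edge-irr = edge-irr A
  }

IsHom : FinGraph n → FinGraph k → (Fin n → Fin k) → Set
IsHom A F f = ∀ i j → T (edge A i j) → T (edge F (f i) (f j))

-- Mediates between a function and its table, which agree only pointwise.
IsHom-cong : (A : FinGraph n) (F : FinGraph k) {f g : Fin n → Fin k} → (∀ i → f i ≡ g i) → IsHom A F f → IsHom A F g
IsHom-cong A F f≗g h i j e = subst₂ (λ x y → T (edge F x y)) (f≗g i) (f≗g j) (h i j e)

isHom? : (A : FinGraph n) (F : FinGraph k) → Decidable (λ f → IsHom A F (Vec.lookup f))
isHom? A F f = all? λ i → all? λ j → T? (edge A i j) →-dec T? (edge F (Vec.lookup f i) (Vec.lookup f j))

homs : FinGraph n → FinGraph k → List (Vec (Fin k) n)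
homs {n} {k} A F = filter (isHom? A F) (allMaps n k)

#hom : FinGraph n → FinGraph k → ℕ
#hom A F = length (homs A F)

homs-unique : (A : FinGraph n) (F : FinGraph k) → Unique (homs A F)
homs-unique A F = Unique.filter⁺ (isHom? A F) (allMaps-unique _ _)

∈-homs⁺ : (A : FinGraph n) (F : FinGraph k) {f : Vec (Fin k) n} → IsHom A F (Vec.lookup f) → f ∈ homs A F
∈-homs⁺ A F {f} = ∈-filter⁺ (isHom? A F) (∈-allMaps f)

∈-homs⁻ : (A : FinGraph n) (F : FinGraph k) {f : Vec (Fin k) n} → f ∈ homs A F → IsHom A F (Vec.lookup f)
∈-homs⁻ A F {f} f∈ = proj₂ (∈-filter⁻ (isHom? A F) {v = f} {xs = allMaps _ _} f∈)

Isolated : FinGraph n → Fin n → Set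
Isolated A v = ∀ j → ¬ T (edge A v j)

NoIsolated : FinGraph n → Set
NoIsolated A = ∀ v → ∃ λ j → T (edge A v j)

isolated⊎none : (A : FinGraph n) → (∃ λ v → Isolated A v) ⊎ NoIsolated A
isolated⊎none {n} A with all? (λ v → any? (λ j → T? (edge A v j)))
... | yes none = inj₂ none
... | no ¬none with v , ¬e ← ¬∀⟶∃¬ n _ (λ v → any? (λ j → T? (edge A v j))) ¬none = inj₁ (v , λ j e → ¬e (j , e))

-- Deleting isolated vertices

-- Separates the deleted vertex from the surviving ones, whose edges are by definition those of
-- `delete v A`.
data PunchView {n} (v : Fin (suc n)) : Fin (suc n) → Set where
  hole  : PunchView v v
  other : ∀ i → PunchView v (punchIn v i)

punchView : (v i : Fin (suc n)) → PunchView v i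
punchView v i with v ≟ i
... | yes refl = hole
... | no v≢i = subst (PunchView v) (punchIn-punchOut v≢i) (other (punchOut v≢i))

lookup-removeAt : {X : Set} (f : Vec X (suc n)) (v : Fin (suc n)) (i : Fin n) →
  Vec.lookup (removeAt f v) i ≡ Vec.lookup f (punchIn v i)
lookup-removeAt f v i = trans
  (sym (insertAt-punchIn (removeAt f v) v (Vec.lookup f v) i))
  (cong (λ g → Vec.lookup g (punchIn v i)) (insertAt-removeAt f v))

-- A homomorphism from `A` amounts to a free choice for the image of `v` together with a
-- homomorphism from the rest.
#hom-delete : (A : FinGraph (suc n)) (F : FinGraph k) {v : Fin (suc n)} → Isolated A v →
  #hom A F ≡ k * #hom (delete v A) F
#hom-delete {n} {k} A F {v} v-iso = trans (≤-antisym split join) length-P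
  where
  A′ = delete v A
  P = cartesianProduct (allFin k) (homs A′ F)

  length-P : length P ≡ k * #hom A′ F
  length-P = trans (length-cartesianProduct (allFin k) (homs A′ F)) (cong (_* #hom A′ F) (length-tabulate {n = k} id))

  split : #hom A F ≤ length P
  split = injection⇒length≤ (λ f → Vec.lookup f v , removeAt f v) (homs-unique A F)
    (λ {f} f∈ → ∈-cartesianProduct⁺ (∈-allFin _) (∈-homs⁺ A′ F
      (IsHom-cong A′ F (sym ∘ lookup-removeAt f v) λ i j → ∈-homs⁻ A F f∈ _ _)))
    (λ {f} {g} _ _ eq → trans (sym (insertAt-removeAt f v))
      (trans (cong₂ (λ x h → insertAt h v x) (cong proj₁ eq) (cong proj₂ eq)) (insertAt-removeAt g v)))

  extend : ∀ {x f} → IsHom A′ F (Vec.lookup f) → IsHom A F (Vec.lookup (insertAt f v x))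
  extend h i j e with punchView v i | punchView v j
  ... | hole     | _        = contradiction e (v-iso j)
  ... | other i′ | hole     = contradiction (edge-sym A e) (v-iso i)
  extend {x} {f} h _ _ e | other i′ | other j′
    rewrite insertAt-punchIn f v x i′ | insertAt-punchIn f v x j′ = h i′ j′ e

  join : length P ≤ #hom A F
  join = injection⇒length≤ (λ { (x , f) → insertAt f v x })
    (Unique.cartesianProduct⁺ (Unique.allFin⁺ k) (homs-unique A′ F))
    (λ p → ∈-homs⁺ A F (extend (∈-homs⁻ A′ F (proj₂ (∈-cartesianProduct⁻ (allFin k) (homs A′ F) p)))))
    (λ { {x , f} {y , g} _ _ eq → cong₂ _,_
      (trans (sym (insertAt-lookup f v x)) (trans (cong (λ h → Vec.lookup h v) eq) (insertAt-lookup g v y)))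
      (lookup-injective λ i → trans (sym (insertAt-punchIn f v x i))
        (trans (cong (λ h → Vec.lookup h (punchIn v i)) eq) (insertAt-punchIn g v y i))) })

-- Detecting isolated vertices

-- An isolated vertex can be sent to the added point, other vertices cannot.

#hom-addPoint-noIsolated : (A : FinGraph n) (F : FinGraph k) → NoIsolated A → #hom A (addPoint F) ≤ #hom A F
#hom-addPoint-noIsolated A F none = ≤-trans
  (⊆⇒length≤ {ys = map (Vec.map suc) (homs A F)} (homs-unique A (addPoint F)) lower)
  (≤-reflexive (length-map (Vec.map suc) (homs A F)))
  where
  lower : ∀ {f} → f ∈ homs A (addPoint F) → f ∈ map (Vec.map suc) (homs A F)
  lower {f} f∈ = subst (_∈ map (Vec.map suc) (homs A F)) (sym f≡) (∈-map⁺ (Vec.map suc) (∈-homs⁺ A F g-hom))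
    where
    h = ∈-homs⁻ A (addPoint F) f∈
    -- No edge meets the added point, and `none` puts an edge at every vertex, so all values are
    -- successors.
    source : ∀ {x y} → T (edge (addPoint F) x y) → ∃ λ z → x ≡ suc z
    source {suc z} e = z , refl
    pre : ∀ i → ∃ λ z → Vec.lookup f i ≡ suc z
    pre i = source (h i _ (proj₂ (none i)))
    g = tabulate (proj₁ ∘ pre)
    f≗ : ∀ i → Vec.lookup f i ≡ suc (Vec.lookup g i)
    f≗ i = trans (proj₂ (pre i)) (cong suc (sym (lookup∘tabulate (proj₁ ∘ pre) i)))
    f≡ : f ≡ Vec.map suc g
    f≡ = lookup-injective λ i → trans (f≗ i) (sym (lookup-map i suc g))
    g-hom : IsHom A F (Vec.lookup g)
    g-hom = IsHom-cong A (addPoint F) f≗ h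

-- The homomorphisms into `F` lift along `suc`. Redirecting `v` to `zero` in one of them gives
-- `new`, which is not a lift; positivity supplies one to redirect.
#hom-addPoint-isolated : (A : FinGraph n) (F : FinGraph k) {v : Fin n} → Isolated A v →
  0 < #hom A F → #hom A F < #hom A (addPoint F)
#hom-addPoint-isolated {n} {k} A F {v} v-iso pos = ≤-trans
  (s≤s (≤-reflexive (sym (length-map (Vec.map suc) (homs A F)))))
  (⊆⇒length≤ {xs = new ∷ map (Vec.map suc) (homs A F)} (new∉ ∷ Unique.map⁺ map-suc-injective (homs-unique A F)) into)
  where
  witness = 0<length⇒∃∈ {xs = homs A F} pos
  f₀ = proj₁ witness
  h₀ = ∈-homs⁻ A F (proj₂ witness)
  raised = Vec.map suc f₀
  new = raised [ v ]≔ zero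

  map-suc-injective : {f g : Vec (Fin k) n} → Vec.map suc f ≡ Vec.map suc g → f ≡ g
  map-suc-injective {f} {g} eq = lookup-injective λ i → suc-injective
    (trans (sym (lookup-map i suc f)) (trans (cong (λ h → Vec.lookup h i) eq) (lookup-map i suc g)))

  raise-hom : ∀ {f} → IsHom A F (Vec.lookup f) → IsHom A (addPoint F) (Vec.lookup (Vec.map suc f))
  raise-hom {f} h = IsHom-cong A (addPoint F) (λ i → sym (lookup-map i suc f)) h

  new∉ : All (new ≢_) (map (Vec.map suc) (homs A F))
  new∉ = All.map⁺ (All.universal (λ f eq → 0≢1+n (trans (sym (lookup∘update v raised zero))
      (trans (cong (λ h → Vec.lookup h v) eq) (lookup-map v suc f)))) (homs A F))

  new-hom : IsHom A (addPoint F) (Vec.lookup new)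
  new-hom i j e with i ≟ v | j ≟ v
  ... | yes refl | _        = contradiction e (v-iso j)
  ... | no _     | yes refl = contradiction (edge-sym A e) (v-iso i)
  ... | no i≢v   | no j≢v
    rewrite lookup∘update′ i≢v raised zero | lookup∘update′ j≢v raised zero = raise-hom {f₀} h₀ i j e

  into : ∀ {f} → f ∈ new ∷ map (Vec.map suc) (homs A F) → f ∈ homs A (addPoint F)
  into (here refl) = ∈-homs⁺ A (addPoint F) new-hom
  into (there p) with g , g∈ , refl ← ∈-map⁻ (Vec.map suc) p = ∈-homs⁺ A (addPoint F) (raise-hom {g} (∈-homs⁻ A F g∈))

-- The added point strictly raises the count for `A` and would not raise that for `B`.
isolated-transfers : (A : FinGraph n) (B : FinGraph m) (F : FinGraph k) →
  #hom A F ≡ #hom B F → #hom A (addPoint F) ≡ #hom B (addPoint F) → 0 < #hom A F →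
  (∃ λ v → Isolated A v) → ¬ NoIsolated B
isolated-transfers A B F eq eq⁺ pos (v , v-iso) none = <-irrefl eq (begin-strict
  #hom A F             <⟨ #hom-addPoint-isolated A F v-iso pos ⟩
  #hom A (addPoint F)  ≡⟨ eq⁺ ⟩
  #hom B (addPoint F)  ≤⟨ #hom-addPoint-noIsolated B F none ⟩
  #hom B F             ∎)
  where open ≤-Reasoning

-- Arcs and colourings

arcs : FinGraph n → List (Fin n × Fin n)
arcs {n} A = filter (λ p → T? (edge A (proj₁ p) (proj₂ p))) (cartesianProduct (allFin n) (allFin n))

arcs-unique : (A : FinGraph n) → Unique (arcs A)
arcs-unique A = Unique.filter⁺ _ (Unique.cartesianProduct⁺ (Unique.allFin⁺ _) (Unique.allFin⁺ _))

∈-arcs⁺ : (A : FinGraph n) {i j : Fin n} → T (edge A i j) → (i , j) ∈ arcs A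
∈-arcs⁺ A = ∈-filter⁺ _ (∈-cartesianProduct⁺ (∈-allFin _) (∈-allFin _))

∈-arcs⁻ : (A : FinGraph n) {p : Fin n × Fin n} → p ∈ arcs A → T (edge A (proj₁ p) (proj₂ p))
∈-arcs⁻ {n} A p∈ = proj₂ (∈-filter⁻ (λ p → T? (edge A (proj₁ p) (proj₂ p))) {xs = cartesianProduct (allFin n) (allFin n)} p∈)

-- Every vertex picks an arc that starts at it, and different vertices pick different arcs.
noIsolated⇒order≤#arcs : (A : FinGraph n) → NoIsolated A → n ≤ length (arcs A)
noIsolated⇒order≤#arcs {n} A none = ≤-trans
  (≤-reflexive (sym (length-tabulate {n = n} id)))
  (injection⇒length≤ (λ i → i , proj₁ (none i)) (Unique.allFin⁺ n)
    (λ {i} _ → ∈-arcs⁺ A (proj₂ (none i))) (λ _ _ → cong proj₁))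

#arcs-delete : (A : FinGraph (suc n)) (v : Fin (suc n)) → length (arcs (delete v A)) ≤ length (arcs A)
#arcs-delete A v = injection⇒length≤ (λ p → punchIn v (proj₁ p) , punchIn v (proj₂ p)) (arcs-unique (delete v A))
  (λ p∈ → ∈-arcs⁺ A (∈-arcs⁻ (delete v A) p∈))
  (λ _ _ eq → cong₂ _,_ (punchIn-injective v _ _ (cong proj₁ eq)) (punchIn-injective v _ _ (cong proj₂ eq)))

-- Isolated vertices are deleted one by one; what is left has at most `M` vertices, which all
-- receive different colours. The extra colour serves the case `M` = 0, where isolated vertices
-- still need an image.
colourable : ∀ {M} (A : FinGraph n) → length (arcs A) ≤ M → 0 < #hom A (complete (suc M))
colourable {n} {M} A bound with isolated⊎none A
... | inj₂ none = ∈-length (∈-homs⁺ A K {tabulate colour} (IsHom-cong A K (sym ∘ lookup∘tabulate colour) colour-hom))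
  where
  K = complete (suc M)
  n≤ : n ≤ suc M
  n≤ = m≤n⇒m≤1+n (≤-trans (noIsolated⇒order≤#arcs A none) bound)
  colour : Fin n → Fin (suc M)
  colour i = inject≤ i n≤
  colour-hom : IsHom A K colour
  colour-hom i j e = fromWitness λ eq → edge-irr A (subst (T ∘ edge A i) (sym (inject≤-injective n≤ n≤ i j eq)) e)
colourable {suc n} {M} A bound | inj₁ (v , v-iso)
  rewrite #hom-delete A (complete (suc M)) v-iso
  = ≤-trans (colourable (delete v A) (≤-trans (#arcs-delete A v) bound)) (m≤m+n _ _)

-- Isomorphisms and bijections of finite sets

Iso : FinGraph n → FinGraph m → Set
Iso {n} {m} A B = Σ (Fin n ↔ Fin m) λ φ → ∀ i j → edge B (Inverse.to φ i) (Inverse.to φ j) ≡ edge A i j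

insert-iso : (A : FinGraph (suc n)) (B : FinGraph (suc m)) {v : Fin (suc n)} {w : Fin (suc m)} →
  Isolated A v → Isolated B w → Iso (delete v A) (delete w B) → Iso A B
insert-iso A B {v} {w} v-iso w-iso (π , π-iso) = insert v w π , preserves
  where
  insert-hole : insert v w π ⟨$⟩ʳ v ≡ w
  insert-hole with v ≟ v
  ... | yes _  = refl
  ... | no v≢v = contradiction refl v≢v

  preserves : ∀ i j → edge B (insert v w π ⟨$⟩ʳ i) (insert v w π ⟨$⟩ʳ j) ≡ edge A i j
  preserves i j with punchView v i | punchView v j
  ... | hole | _ rewrite insert-hole = T-ext (λ e → contradiction e (w-iso _)) (λ e → contradiction e (v-iso _))
  ... | other i′ | hole rewrite insert-hole =
    T-ext (λ e → contradiction (edge-sym B e) (w-iso _)) (λ e → contradiction (edge-sym A e) (v-iso _))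
  ... | other i′ | other j′ rewrite insert-punchIn v w π i′ | insert-punchIn v w π j′ = π-iso i′ j′

Surjective : (Fin m → Fin n) → Set
Surjective f = ∀ y → ∃ λ x → f x ≡ y

surjective⇒≥ : {f : Fin m → Fin n} → Surjective f → n ≤ m
surjective⇒≥ {f = f} surj = injective⇒≤ {f = proj₁ ∘ surj} λ {x} {y} eq →
  trans (sym (proj₂ (surj x))) (trans (cong f eq) (proj₂ (surj y)))

-- A missed value could be punched out of the codomain, leaving an injection into fewer than `n`
-- elements.
injective⇒surjective : (s : Fin n → Fin m) → m ≤ n → (∀ {x y} → s x ≡ s y → x ≡ y) → Surjective s
injective⇒surjective {n} {suc m} s m≤n inj y with any? (λ x → s x ≟ y)
... | yes p = p
... | no ¬p = contradiction (≤-trans m≤n (injective⇒≤ {f = λ x → punchOut (missed x)} λ eq →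
                inj (punchOut-injective (missed _) (missed _) eq))) (<-irrefl refl)
  where
  missed : ∀ x → y ≢ s x
  missed x eq = ¬p (x , sym eq)

-- A section of `f` is injective, hence surjective by the sizes, hence a two-sided inverse.
surjective⇒↔ : (f : Fin m → Fin n) → m ≤ n → Surjective f → Fin m ↔ Fin n
surjective⇒↔ f m≤n surj = mk↔ₛ′ f s f∘s s∘f
  where
  s = proj₁ ∘ surj
  f∘s : ∀ y → f (s y) ≡ y
  f∘s = proj₂ ∘ surj
  s-surj : Surjective s
  s-surj = injective⇒surjective s m≤n λ {x} {y} eq → trans (sym (f∘s x)) (trans (cong f eq) (f∘s y))
  s∘f : ∀ x → s (f x) ≡ x
  s∘f x with y , refl ← s-surj x = cong s (f∘s y)

-- If f were to create an edge out of the non-edge (i , j), then g ∘ f would inject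
-- the arcs of A together with (i , j) into the arcs of A.
injective-homs-reflect : (A : FinGraph n) (B : FinGraph m) {f : Fin n → Fin m} {g : Fin m → Fin n} →
  IsHom A B f → IsHom B A g → (∀ {x y} → f x ≡ f y → x ≡ y) → (∀ {x y} → g x ≡ g y → x ≡ y) →
  ∀ i j → T (edge B (f i) (f j)) → T (edge A i j)
injective-homs-reflect A B {f} {g} f-hom g-hom f-inj g-inj i j e with T? (edge A i j)
... | yes e′ = e′
... | no ¬e′ = contradiction
    (injection⇒length≤ {xs = (i , j) ∷ arcs A} (λ p → g (f (proj₁ p)) , g (f (proj₂ p)))
      (All.tabulate (λ { p∈ refl → ¬e′ (∈-arcs⁻ A p∈) }) ∷ arcs-unique A)
      into
      (λ _ _ eq → cong₂ _,_ (f-inj (g-inj (cong proj₁ eq))) (f-inj (g-inj (cong proj₂ eq)))))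
    (<-irrefl refl)
  where
  into : ∀ {p} → p ∈ (i , j) ∷ arcs A → (g (f (proj₁ p)) , g (f (proj₂ p))) ∈ arcs A
  into (here refl) = ∈-arcs⁺ A (g-hom _ _ e)
  into (there p∈)  = ∈-arcs⁺ A (g-hom _ _ (f-hom _ _ (∈-arcs⁻ A p∈)))

-- Surjective homomorphisms

SurjHom : FinGraph n → FinGraph k → Set
SurjHom {n} {k} A F = Σ (Fin n → Fin k) λ f → IsHom A F f × Surjective f

-- A list of values to be hit lets surjectivity be reached by adding one required value at a time.
Hits : List (Fin k) → Vec (Fin k) n → Set
Hits R f = All (λ r → ∃ λ i → Vec.lookup f i ≡ r) R

hits? : (R : List (Fin k)) → Decidable (Hits {n = n} R)
hits? R f = All.all? (λ r → any? (λ i → Vec.lookup f i ≟ r)) R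

homHits? : (A : FinGraph n) (F : FinGraph k) (R : List (Fin k)) →
  Decidable (λ f → IsHom A F (Vec.lookup f) × Hits R f)
homHits? A F R f = isHom? A F f ×-dec hits? R f

#homHits : FinGraph n → FinGraph k → List (Fin k) → ℕ
#homHits {n} {k} A F R = length (filter (homHits? A F R) (allMaps n k))

#homHits-[] : (A : FinGraph n) (F : FinGraph k) → #homHits A F [] ≡ #hom A F
#homHits-[] {n} {k} A F = cong length
  (filter-≐ (homHits? A F []) (isHom? A F) (proj₁ , (λ h → h , [])) (allMaps n k))

-- Without isolated vertices in A, avoiding r amounts to mapping into F with r isolated;
-- so the inclusion–exclusion over images stays among targets with the same vertex set.
#homHits-∷ : (A : FinGraph n) (F : FinGraph k) (r : Fin k) (R : List (Fin k)) → NoIsolated A →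
  #homHits A F R ≡ #homHits A F (r ∷ R) + #homHits A (isolate r F) R
#homHits-∷ {n} {k} A F r R none = trans
  (length-filter-split (homHits? A F R) hit? (allMaps n k))
  (cong₂ _+_
    (cong length (filter-≐ (λ f → homHits? A F R f ×-dec hit? f) (homHits? A F (r ∷ R))
      ((λ { ((h , hs) , hit) → h , hit ∷ hs }) , (λ { (h , hit ∷ hs) → (h , hs) , hit })) (allMaps n k)))
    (cong length (filter-≐ (λ f → homHits? A F R f ×-dec ¬? (hit? f)) (homHits? A (isolate r F) R)
      ((λ { {f} ((h , hs) , miss) → (λ i j e → fromWitness (h i j e , (λ eq → miss (i , eq)) , (λ eq → miss (j , eq)))) , hs })
      , (λ { {f} (h , hs) → ((λ i j e → proj₁ (unpack f i j (h i j e))) , hs)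
           -- Vertex `i` lies on an edge, and images of edges in `isolate r F` stay away from `r`.
           , (λ { (i , eq) → proj₁ (proj₂ (unpack f i _ (h i _ (proj₂ (none i))))) eq }) }))
      (allMaps n k))))
  where
  hit? : Decidable (λ (f : Vec (Fin k) n) → ∃ λ i → Vec.lookup f i ≡ r)
  hit? f = any? (λ i → Vec.lookup f i ≟ r)
  unpack : ∀ (f : Vec (Fin k) n) i j → T (edge (isolate r F) (Vec.lookup f i) (Vec.lookup f j)) →
    T (edge F (Vec.lookup f i) (Vec.lookup f j)) × Vec.lookup f i ≢ r × Vec.lookup f j ≢ r
  unpack f i j e = toWitness e

-- Induction on `R` for all `F` at once: the induction hypothesis is used for `F` and for
-- `isolate r F`, and the common summand cancels.
#homHits-agree : (A : FinGraph n) (B : FinGraph m) → NoIsolated A → NoIsolated B →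
  (∀ (F : FinGraph k) → #hom A F ≡ #hom B F) →
  ∀ R (F : FinGraph k) → #homHits A F R ≡ #homHits B F R
#homHits-agree A B a b same []      F = trans (#homHits-[] A F) (trans (same F) (sym (#homHits-[] B F)))
#homHits-agree A B a b same (r ∷ R) F = +-cancelʳ-≡ (#homHits A (isolate r F) R) _ _ (begin
  #homHits A F (r ∷ R) + #homHits A (isolate r F) R  ≡⟨ #homHits-∷ A F r R a ⟨
  #homHits A F R                                     ≡⟨ #homHits-agree A B a b same R F ⟩
  #homHits B F R                                     ≡⟨ #homHits-∷ B F r R b ⟩
  #homHits B F (r ∷ R) + #homHits B (isolate r F) R  ≡⟨ cong (#homHits B F (r ∷ R) +_) (#homHits-agree A B a b same R (isolate r F)) ⟨
  #homHits B F (r ∷ R) + #homHits A (isolate r F) R  ∎)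
  where open ≡-Reasoning

-- With all vertices of `F` as the list `R`, `#homHits` counts surjective homomorphisms, so its
-- positivity passes from `A` to `B`.
surjHom-transfers : (A : FinGraph n) (B : FinGraph m) → NoIsolated A → NoIsolated B →
  (∀ (F : FinGraph k) → #hom A F ≡ #hom B F) → (F : FinGraph k) → SurjHom A F → SurjHom B F
surjHom-transfers {k = k} A B a b same F (f , f-hom , f-surj) = Vec.lookup g , g-hom , λ y → All.lookup g-hits (∈-allFin y)
  where
  positive : 0 < #homHits A F (allFin k)
  positive = ∈-length (∈-filter⁺ (homHits? A F (allFin k)) (∈-allMaps (tabulate f))
    ( IsHom-cong A F (sym ∘ lookup∘tabulate f) f-hom
    , All.universal (λ y → proj₁ (f-surj y) , trans (lookup∘tabulate f _) (proj₂ (f-surj y))) (allFin k)))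
  witness = 0<length⇒∃∈ (subst (0 <_) (#homHits-agree A B a b same (allFin k) F) positive)
  g = proj₁ witness
  g-props = proj₂ (∈-filter⁻ (homHits? B F (allFin k)) {v = g} {xs = allMaps _ k} (proj₂ witness))
  g-hom = proj₁ g-props
  g-hits = proj₂ g-props

-- Recolouring one of two vertices with the same image by a new colour.
surjHom-complete : (B : FinGraph m) (A : FinGraph n) → n < m → SurjHom B A → SurjHom B (complete (suc n))
surjHom-complete {m} {n} B A n<m (g , g-hom , g-surj)
  with u , v , u<v , gu≡gv ← pigeonhole n<m g = c , c-hom , c-surj
  where
  u≢v : u ≢ v
  u≢v refl = <-irrefl refl u<v

  c : Fin m → Fin (suc n)
  c x with x ≟ u
  ... | yes _ = zero
  ... | no _  = suc (g x)

  c-u : c u ≡ zero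
  c-u with u ≟ u
  ... | yes _  = refl
  ... | no u≢u = contradiction refl u≢u

  c-other : ∀ {x} → x ≢ u → c x ≡ suc (g x)
  c-other {x} x≢u with x ≟ u
  ... | yes x≡u = contradiction x≡u x≢u
  ... | no _    = refl

  c-hom : IsHom B (complete (suc n)) c
  c-hom i j e = fromWitness (proper i j e)
    where
    proper : ∀ i j → T (edge B i j) → c i ≢ c j
    proper i j e eq with i ≟ u | j ≟ u
    ... | yes refl | yes refl = edge-irr B e
    ... | no _     | no _     = edge-irr A (subst (λ y → T (edge A (g i) y)) (sym (suc-injective eq)) (g-hom i j e))
    proper i j e () | yes _ | no _
    proper i j e () | no _  | yes _

  c-surj : Surjective c
  c-surj zero = u , c-u
  c-surj (suc y) with x , refl ← g-surj y with x ≟ u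
  -- The recoloured `u` has given up its old colour, but `v` still carries it.
  ... | yes refl = v , trans (c-other (u≢v ∘ sym)) (cong suc (sym gu≡gv))
  ... | no x≢u   = x , c-other x≢u

-- Recovering a graph from its homomorphism counts

-- Targets have from 1 to `N` vertices; `suc k` excludes the empty graph, which is no `Graph`.
SameHoms : ℕ → FinGraph n → FinGraph m → Set
SameHoms N A B = ∀ k → k < N → (F : FinGraph (suc k)) → #hom A F ≡ #hom B F

-- The largest target used is complete with one vertex more than `A`, whence the condition `n < N`.
noIsolated-iso : ∀ {N} (A : FinGraph n) (B : FinGraph m) → NoIsolated A → NoIsolated B → n < N →
  SameHoms N A B → Iso A B
noIsolated-iso {zero} {zero} A B a b n<N same = mk↔ₛ′ id id (λ _ → refl) (λ _ → refl) , λ ()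
-- The empty graph maps to a single vertex, so `B` would map there too, in spite of its edge.
noIsolated-iso {zero} {suc m} A B a b n<N same
  with j , e ← b zero
  with f , f∈ ← 0<length⇒∃∈ {xs = homs B (complete 1)} (subst (0 <_) (same 0 n<N (complete 1)) (s≤s z≤n))
  = contradiction (Fin1-unique _ _) (toWitness (∈-homs⁻ B (complete 1) f∈ zero j e))
  where
  Fin1-unique : (x y : Fin 1) → x ≡ y
  Fin1-unique zero zero = refl
noIsolated-iso {suc n} {m} {N} A B a b n<N same = conclude (↔⇒≡ ψ)
  where
  same′ = λ k k<N → sym ∘ same k k<N

  B→A : SurjHom B A
  B→A = surjHom-transfers A B a b (same n (≤-trans (n≤1+n _) n<N)) A (id , (λ _ _ e → e) , λ y → y , refl)

  m≤n : m ≤ suc n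
  m≤n with suc n <? m
  ... | no n≮m  = ≮⇒≥ n≮m
  -- Otherwise `A` would map onto a complete graph with more vertices than `A` has.
  ... | yes n<m = contradiction
    (surjective⇒≥ (proj₂ (proj₂ (surjHom-transfers B A b a (same′ (suc n) n<N) (complete (2 + n)) (surjHom-complete B A n<m B→A)))))
    (<-irrefl refl)

  ψ : Fin m ↔ Fin (suc n)
  ψ = surjective⇒↔ (proj₁ B→A) m≤n (proj₂ (proj₂ B→A))

  -- Once the orders are identified, `B` is itself a target covered by `same′ n`.
  conclude : m ≡ suc n → Iso A B
  conclude refl = φ , λ i j → T-ext
      (injective-homs-reflect A B (proj₁ (proj₂ A→B)) (proj₁ (proj₂ B→A))
        (Injection.injective (↔⇒↣ φ)) (Injection.injective (↔⇒↣ ψ)) i j)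
      (proj₁ (proj₂ A→B) i j)
    where
    A→B : SurjHom A B
    A→B = surjHom-transfers B A b a (same′ n (≤-trans (n≤1+n _) n<N)) B (id , (λ _ _ e → e) , λ y → y , refl)
    φ : Fin (suc n) ↔ Fin (suc n)
    φ = surjective⇒↔ (proj₁ A→B) ≤-refl (proj₂ (proj₂ A→B))

-- Induction on the order, with `M` fixed because deletion creates no arcs. The largest target is
-- `addPoint K` with `2 + M` vertices, where `K` has enough colours for `A`.
sameHoms⇒iso : ∀ {M} (A : FinGraph n) (B : FinGraph m) → length (arcs A) ≤ M → SameHoms (2 + M) A B → Iso A B
sameHoms⇒iso {n} {m} {M} A B bound same = cases (isolated⊎none A) (isolated⊎none B)
  where
  K = complete (suc M)
  same-K = same M (m≤n⇒m≤1+n (n<1+n M)) K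
  same-K⁺ = same (suc M) (n<1+n (suc M)) (addPoint K)
  A-pos : 0 < #hom A K
  A-pos = colourable A bound

  cases : (∃ λ v → Isolated A v) ⊎ NoIsolated A → (∃ λ w → Isolated B w) ⊎ NoIsolated B → Iso A B
  cases (inj₂ a) (inj₂ b) = noIsolated-iso A B a b
    (s≤s (m≤n⇒m≤1+n (≤-trans (noIsolated⇒order≤#arcs A a) bound))) same
  cases (inj₁ v) (inj₂ b) = contradiction b (isolated-transfers A B K same-K same-K⁺ A-pos v)
  cases (inj₂ a) (inj₁ w) = contradiction a
    (isolated-transfers B A K (sym same-K) (sym same-K⁺) (subst (0 <_) same-K A-pos) w)
  cases (inj₁ (v , v-iso)) (inj₁ (w , w-iso)) = both A B bound same v-iso w-iso
    where
    -- Generalised over the orders so that they can be matched as successors, `v` and `w` ruling out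
    -- zero.
    both : ∀ {n m} (A : FinGraph n) (B : FinGraph m) → length (arcs A) ≤ M → SameHoms (2 + M) A B →
      {v : Fin n} {w : Fin m} → Isolated A v → Isolated B w → Iso A B
    both {suc n} {suc m} A B bound same {v} {w} v-iso w-iso = insert-iso A B v-iso w-iso
      (sameHoms⇒iso (delete v A) (delete w B) (≤-trans (#arcs-delete A v) bound)
        -- Each deletion contributes the factor `suc k`, which is nonzero and can be cancelled.
        λ k k<N F → *-cancelˡ-≡ _ _ (suc k)
          (trans (sym (#hom-delete A F v-iso)) (trans (same k k<N F) (#hom-delete B F w-iso))))

-- Graphs in the sense of the statement

fromGraph : (G : Graph) → FinGraph (size G)
fromGraph G = record
  { edge     = adj G
  ; edge-sym = λ {i} {j} → subst T (adj-sym G i j)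
  ; edge-irr = λ {i} → subst T (adj-irr G i)
  }

toGraph : FinGraph (suc k) → Graph
toGraph {k} F = record
  { size     = suc k
  ; nonEmpty = z<s
  ; adj      = edge F
  ; adj-sym  = λ i j → T-ext (edge-sym F) (edge-sym F)
  ; adj-irr  = λ i → T-ext (edge-irr F) ⊥-elim
  }

T-implies⁺ : ∀ {x y} → (T x → T y) → T (not x ∨ y)
T-implies⁺ {true}  f = f _
T-implies⁺ {false} f = _

T-implies⁻ : ∀ {x y} → T (not x ∨ y) → T x → T y
T-implies⁻ {true} p _ = p

hom≡#hom : (G : Graph) (F : FinGraph (suc k)) → hom G (toGraph F) ≡ #hom (fromGraph G) F
hom≡#hom {k} G F = cong length (filter-≐ (T? ∘ isHom G (toGraph F)) (isHom? (fromGraph G) F)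
  ( (λ {f} h i j → T-implies⁻ (All.lookup (All.all⁺ (preserves f) (pairs G) h) (∈-cartesianProduct⁺ (∈-allFin i) (∈-allFin j))))
  , (λ {f} h → All.all⁻ (preserves f) (All.universal (λ p → T-implies⁺ (h (proj₁ p) (proj₂ p))) (pairs G))))
  (allMaps (size G) (suc k)))
  where
  preserves : Vec (Fin (suc k)) (size G) → Fin (size G) × Fin (size G) → Bool
  preserves f p = not (adj G (proj₁ p) (proj₂ p)) ∨ edge F (Vec.lookup f (proj₁ p)) (Vec.lookup f (proj₂ p))

-- `edges` counts the adjacent pairs in increasing order; every arc is such a pair or the swap of
-- one.
#arcs≤2edges : (G : Graph) → length (arcs (fromGraph G)) ≤ edges G + edges G
#arcs≤2edges G = ≤-trans (⊆⇒length≤ (arcs-unique A) oriented) (≤-reflexive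
  (trans (length-++ increasing) (cong (edges G +_) (length-map swap increasing))))
  where
  A = fromGraph G
  test : Fin (size G) × Fin (size G) → Bool
  test p = (toℕ (proj₁ p) <ᵇ toℕ (proj₂ p)) ∧ adj G (proj₁ p) (proj₂ p)
  increasing = filter (T? ∘ test) (pairs G)

  ∈-increasing : ∀ {i j} → toℕ i < toℕ j → T (adj G i j) → (i , j) ∈ increasing
  ∈-increasing i<j e = ∈-filter⁺ (T? ∘ test) (∈-cartesianProduct⁺ (∈-allFin _) (∈-allFin _))
    (Equivalence.from T-∧ (<⇒<ᵇ i<j , e))

  oriented : ∀ {p} → p ∈ arcs A → p ∈ increasing ++ map swap increasing
  oriented {i , j} p∈ with e ← ∈-arcs⁻ A p∈ | <-cmp (toℕ i) (toℕ j)
  ... | tri< i<j _ _ = ∈-++⁺ˡ (∈-increasing i<j e)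
  ... | tri> _ _ j<i = ∈-++⁺ʳ increasing (∈-map⁺ swap (∈-increasing j<i (edge-sym A e)))
  ... | tri≈ _ i≡j _ = contradiction (subst (T ∘ adj G i) (sym (toℕ-injective i≡j)) e) (edge-irr A)

-- A finite list of targets, and the theorem

-- Every table is read as a graph by symmetrising it and ignoring its diagonal.
decode : Vec (Fin 2) (n * n) → FinGraph n
decode {n} t = fromDec {R = λ i j → i ≢ j × (at i j ⊎ at j i)}
  (λ i j → ¬? (i ≟ j) ×-dec (at? i j ⊎-dec at? j i))
  (λ { (i≢j , inj₁ p) → i≢j ∘ sym , inj₂ p ; (i≢j , inj₂ p) → i≢j ∘ sym , inj₁ p })
  (λ p → proj₁ p refl)
  where
  at : Fin n → Fin n → Set
  at i j = Vec.lookup t (combine i j) ≡ suc zero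
  at? : ∀ i j → Dec (at i j)
  at? i j = Vec.lookup t (combine i j) ≟ suc zero

bit : Bool → Fin 2
bit b = if b then suc zero else zero

bit⁺ : ∀ {b} → T b → bit b ≡ suc zero
bit⁺ {true} _ = refl

bit⁻ : ∀ {b} → bit b ≡ suc zero → T b
bit⁻ {true}  _ = _
bit⁻ {false} ()

encode : FinGraph n → Vec (Fin 2) (n * n)
encode {n} F = tabulate λ p → bit (edge F (proj₁ (remQuot {n} n p)) (proj₂ (remQuot {n} n p)))

lookup-encode : (F : FinGraph n) (i j : Fin n) → Vec.lookup (encode F) (combine i j) ≡ bit (edge F i j)
lookup-encode F i j = trans (lookup∘tabulate _ (combine i j))
  (cong (λ p → bit (edge F (proj₁ p) (proj₂ p))) (remQuot-combine i j))

decode-encode : (F : FinGraph n) (i j : Fin n) → edge (decode (encode F)) i j ≡ edge F i j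
decode-encode F i j = T-ext (λ e → sound (toWitness e))
  (λ e → fromWitness ((λ { refl → edge-irr F e }) , inj₁ (trans (lookup-encode F i j) (bit⁺ e))))
  where
  sound : i ≢ j × (Vec.lookup (encode F) (combine i j) ≡ suc zero ⊎ Vec.lookup (encode F) (combine j i) ≡ suc zero) →
    T (edge F i j)
  sound (_ , inj₁ p) = bit⁻ (trans (sym (lookup-encode F i j)) p)
  sound (_ , inj₂ p) = edge-sym F (bit⁻ (trans (sym (lookup-encode F j i)) p))

-- Serves to replace `F` by `decode (encode F)`, which has the same edges pointwise.
#hom-congʳ : (A : FinGraph n) {F F′ : FinGraph k} → (∀ i j → edge F i j ≡ edge F′ i j) → #hom A F ≡ #hom A F′
#hom-congʳ {n} {k} A {F} {F′} eq = cong length (filter-≐ (isHom? A F) (isHom? A F′)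
  ((λ h i j e → subst T (eq _ _) (h i j e)) , (λ h i j e → subst T (sym (eq _ _)) (h i j e))) (allMaps n k))

-- Running through all tables yields every graph on `Fin 1` up to `Fin N`, possibly with
-- repetitions.
targets : ℕ → List Graph
targets N = concatMap (λ k → map (toGraph ∘ decode {suc k}) (allMaps (suc k * suc k) 2)) (upTo N)

∈-targets : ∀ {N} → k < N → (t : Vec (Fin 2) (suc k * suc k)) → toGraph (decode t) ∈ targets N
∈-targets k<N t = ∈-concatMap⁺ _
  (Any.map (λ { refl → ∈-map⁺ (toGraph ∘ decode) (∈-allMaps t) }) (∈-upTo⁺ k<N))

theorem9p4 : (C : Graph → Set) → ClosedUnderIso C → EdgeBounded C → HasRightHomAlgorithm C
theorem9p4 C closed (b , bounded) =
  -- The list is non-empty, as it contains the graph with one vertex.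
  length (targets N) , ∈-length (∈-targets {0} {N} z<s (encode (complete 1))) , lookup (targets N) ,
  -- The edge bound comes from whichever graph lies in `C`, so both directions are one argument.
  λ G H same → transport G H same , transport H G (sym ∘ same)
  where
  -- At most `b` edges give at most `b + b` arcs, the `M` of `sameHoms⇒iso`.
  N = 2 + (b + b)

  transport : ∀ G H → (∀ i → hom G (lookup (targets N) i) ≡ hom H (lookup (targets N) i)) → C G → C H
  transport G H same c = closed G H
    (sameHoms⇒iso (fromGraph G) (fromGraph H)
      (≤-trans (#arcs≤2edges G) (+-mono-≤ (bounded G c) (bounded G c))) sameHoms) c
    where
    sameOn : ∀ {F} → F ∈ targets N → hom G F ≡ hom H F
    sameOn F∈ = subst (λ F → hom G F ≡ hom H F) (sym (lookup-index F∈)) (same (index F∈))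

    sameHoms : SameHoms N (fromGraph G) (fromGraph H)
    sameHoms k k<N F = begin
      #hom (fromGraph G) F   ≡⟨ #hom-congʳ (fromGraph G) {F′} {F} (decode-encode F) ⟨
      #hom (fromGraph G) F′  ≡⟨ hom≡#hom G F′ ⟨
      hom G (toGraph F′)     ≡⟨ sameOn (∈-targets k<N (encode F)) ⟩
      hom H (toGraph F′)     ≡⟨ hom≡#hom H F′ ⟩
      #hom (fromGraph H) F′  ≡⟨ #hom-congʳ (fromGraph H) {F′} {F} (decode-encode F) ⟩
      #hom (fromGraph H) F   ∎
      where
      open ≡-Reasoning
      F′ = decode (encode F)
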